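{- Let $D$ be a strongly connected digraph with minimum in-degree $\delta^-\ge 2$. Then $$\overrightarrow{\gamma}^{ID}(LD)\ge |A(D)|-|V(D)|.$$
   Context: Digraphs are finite, without loops or multiple arcs; digons (both arcs $(u,v)$ and $(v,u)$) are allowed. $V(D)$ and $A(D)$ are the vertex and arc sets. $N^-(u)$ and $N^+(u)$ are the in- and out-neighbourhoods, $N^-[u]=\{u\}\cup N^-(u)$, $N^+[u]=\{u\}\cup N^+(u)$. The line digraph $LD$ of $D$ has vertex set $A(D)$, and a vertex $uv$ (for the arc $(u,v)$) is adjacent to $wz$ if and only if $v=w$. An identifying code of a digraph $G$ is a set $C\subseteq V(G)$ that is dominating ($\bigcup_{c\in C}N^+[c]=V(G)$) and such that $N^-[x]\cap C\ne N^-[y]\cap C$ for all distinct $x,y\in V(G)$. $\overrightarrow{\gamma}^{ID}(G)$ denotes the minimum size of an identifying code of $G$. -}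

module Defs where

open import Data.Nat.Base using (ℕ; _≤_)
open import Data.Fin.Base using (Fin)
open import Data.Fin.Properties using (_≟_)
open import Data.Fin.Subset using (Subset; _∈_; _∩_; _∪_; ⁅_⁆; ∣_∣)
open import Data.List.Base using (List; length; lookup; filter; allFin; cartesianProduct)
open import Data.List.Membership.Propositional.Properties using (∈-lookup; ∈-filter⁻)
open import Data.Product.Base using (_×_; _,_; proj₁; proj₂; ∃-syntax)
open import Data.Vec.Base using (tabulate)
open import Level using (0ℓ)
open import Relation.Binary.Core using (Rel)
open import Relation.Binary.Definitions using (Decidable; Irreflexive)
open import Relation.Binary.Construct.Closure.ReflexiveTransitive using (Star)
open import Relation.Binary.PropositionalEquality using (_≡_; _≢_; refl; sym)
open import Relation.Nullary.Decidable using (does)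

-- Only the inhabitation of u ⟶ v is ever used, so there are no multiple arcs.
record Digraph : Set₁ where
  field
    order  : ℕ
    _⟶_    : Rel (Fin order) 0ℓ
    _⟶?_   : Decidable _⟶_
    irrefl : Irreflexive _≡_ _⟶_

  V : Set
  V = Fin order

  N⁺ N⁻ N⁺[_] N⁻[_] : V → Subset order
  N⁺ u = tabulate (λ v → does (u ⟶? v))
  N⁻ u = tabulate (λ v → does (v ⟶? u))
  N⁺[ u ] = ⁅ u ⁆ ∪ N⁺ u
  N⁻[ u ] = ⁅ u ⁆ ∪ N⁻ u

  -- Every arc occurs exactly once in this list.
  arcs : List (V × V)
  arcs = filter (λ (u , v) → u ⟶? v) (cartesianProduct (allFin order) (allFin order))

  size : ℕ
  size = length arcs

  tail head : Fin size → V
  tail a = proj₁ (lookup arcs a)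
  head a = proj₂ (lookup arcs a)

  tail⟶head : ∀ a → tail a ⟶ head a
  tail⟶head a = proj₂ (∈-filter⁻ (λ (u , v) → u ⟶? v)
    {xs = cartesianProduct (allFin order) (allFin order)} (∈-lookup a))

  StronglyConnected : Set
  StronglyConnected = ∀ u v → Star _⟶_ u v

  MinInDegree≥ : ℕ → Set
  MinInDegree≥ d = ∀ u → d ≤ ∣ N⁻ u ∣

  Dominating : Subset order → Set
  Dominating C = ∀ x → ∃[ c ] (c ∈ C × x ∈ N⁺[ c ])

  Separating : Subset order → Set
  Separating C = ∀ x y → x ≢ y → N⁻[ x ] ∩ C ≢ N⁻[ y ] ∩ C

  IsIdentifyingCode : Subset order → Set
  IsIdentifyingCode C = Dominating C × Separating C

-- The arc (u , v) is represented by its position in the list of arcs of D.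
LD : Digraph → Digraph
LD D = record
  { order  = size
  ; _⟶_    = λ a b → head a ≡ tail b
  ; _⟶?_   = λ a b → head a ≟ tail b
  ; irrefl = λ { {a} refl h≡t → irrefl (sym h≡t) (tail⟶head a) }
  }
  where open Digraph D

-- The minimum is a relation because a digraph with two vertices having the
-- same closed in-neighbourhood has no identifying code at all.
γID[_]≡_ : Digraph → ℕ → Set
γID[ G ]≡ k = (∃[ C ] (IsIdentifyingCode C × ∣ C ∣ ≡ k))
            × (∀ C → IsIdentifyingCode C → k ≤ ∣ C ∣)
  where open Digraph G

{-# OPTIONS --safe #-}

-- If two distinct arcs with the same tail u were both outside a code C, their closed
-- in-neighbourhoods in LD would both meet C in the arcs of C ending at u. So tail is
-- injective on the complement of C, whence |A(D)| - |C| ≤ |V(D)|.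
-- That LD has an identifying code at all is where the in-degree is needed: equal closed
-- in-neighbourhoods of distinct arcs force them to be uv and vu, and an arc wu with
-- w ≠ v then tells them apart.
module Submission where

open import Data.Bool.Properties using () renaming (_≟_ to _≟ᵇ_)
open import Data.Fin.Base using (Fin; zero; suc)
open import Data.Fin.Properties using (_≟_; all?; any?; suc-injective)
open import Data.Fin.Subset using (Subset; inside; outside; _∈_; _∉_; _⊆_; _∩_; _-_; ∁; ⊤; ⁅_⁆; ∣_∣)
open import Data.Fin.Subset.Properties
open import Data.List.Membership.Propositional.Properties
  using (∈-filter⁺; ∈-cartesianProduct⁺; ∈-allFin)
open import Data.List.Relation.Unary.Any using (index)
open import Data.List.Relation.Unary.Any.Properties using (lookup-index)
open import Data.Nat.Base using (_≤_; _<_; z≤n; _+_; _∸_; _≥_)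
open import Data.Nat.Induction using (<-wellFounded)
open import Data.Nat.Properties as ℕ using (module ≤-Reasoning)
open import Data.Product.Base using (_×_; _,_; proj₁; proj₂; ∃-syntax)
open import Data.Sum.Base as Sum using (_⊎_; inj₁; inj₂)
open import Data.Vec.Base using ([]; _∷_; here; there)
open import Data.Vec.Properties using (lookup∘tabulate; []=⇒lookup; lookup⇒[]=; ≡-dec)
open import Function.Base using (_∘_)
open import Induction.WellFounded using (Acc; acc)
open import Relation.Binary.PropositionalEquality
  using (_≡_; _≢_; refl; sym; trans; cong; subst)
open import Relation.Nullary using (yes; no; ¬?; contradiction)
open import Relation.Nullary.Decidable using (dec-true; does; _×-dec_; _→-dec_; decidable-stable)
open import Relation.Unary using (Pred; Decidable)
open import Defs

-- Induction along `p`: a member `zero` claims the point `f zero` of `q`. By injectivity no later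
-- member has that image, so the rest of `p` maps into the strictly smaller set `q - f zero`.
injective-on⇒∣p∣≤∣q∣ : ∀ {m n} (p : Subset n) (q : Subset m) (f : Fin n → Fin m) →
  (∀ {x} → x ∈ p → f x ∈ q) →
  (∀ {x y} → x ∈ p → y ∈ p → f x ≡ f y → x ≡ y) →
  ∣ p ∣ ≤ ∣ q ∣
injective-on⇒∣p∣≤∣q∣ []            q f maps inj = z≤n
injective-on⇒∣p∣≤∣q∣ (outside ∷ p) q f maps inj =
  injective-on⇒∣p∣≤∣q∣ p q (f ∘ suc) (maps ∘ there)
    λ x∈p y∈p → suc-injective ∘ inj (there x∈p) (there y∈p)
injective-on⇒∣p∣≤∣q∣ (inside ∷ p)  q f maps inj = ℕ.≤-<-trans
  (injective-on⇒∣p∣≤∣q∣ p (q - f zero) (f ∘ suc)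
    (λ x∈p → x∈p∧x≢y⇒x∈p-y (maps (there x∈p))
      λ eq → contradiction (inj (there x∈p) here eq) λ ())
    λ x∈p y∈p → suc-injective ∘ inj (there x∈p) (there y∈p))
  (x∈p⇒∣p-x∣<∣p∣ (maps here))

2≤∣p∣⇒∃≢ : ∀ {n} {p : Subset n} → 2 ≤ ∣ p ∣ → ∀ v → ∃[ w ] (w ∈ p × w ≢ v)
2≤∣p∣⇒∃≢ {p = p} 2≤∣p∣ v with any? (λ w → (w ∈? p) ×-dec ¬? (w ≟ v))
... | yes w  = w
... | no  ∄w = contradiction 2≤∣p∣ (ℕ.≤⇒≯ ∣p∣≤1)
  where
  p⊆⁅v⁆ : p ⊆ ⁅ v ⁆
  p⊆⁅v⁆ {w} w∈p = subst (λ v → w ∈ ⁅ v ⁆)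
    (decidable-stable (w ≟ v) λ w≢v → ∄w (w , w∈p , w≢v)) (x∈⁅x⁆ w)

  ∣p∣≤1 : ∣ p ∣ ≤ 1
  ∣p∣≤1 = subst (∣ p ∣ ≤_) (∣⁅x⁆∣≡1 v) (p⊆q⇒∣p∣≤∣q∣ p⊆⁅v⁆)

-- Descent on cardinality: an exhaustive search over subsets either finds a strictly smaller one
-- satisfying `P` or certifies minimality.
minimum : ∀ {n ℓ} {P : Pred (Subset n) ℓ} → Decidable P → ∀ p → P p →
  ∃[ q ] (P q × (∀ r → P r → ∣ q ∣ ≤ ∣ r ∣))
minimum {P = P} P? p Pp = go p Pp (<-wellFounded ∣ p ∣)
  where
  go : ∀ p → P p → Acc _<_ ∣ p ∣ → ∃[ q ] (P q × (∀ r → P r → ∣ q ∣ ≤ ∣ r ∣))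
  go p Pp (acc rec) with anySubset? (λ q → P? q ×-dec (∣ q ∣ ℕ.<? ∣ p ∣))
  ... | yes (q , Pq , q<p) = go q Pq (rec q<p)
  ... | no  ∄smaller       = p , Pp , λ r Pr → ℕ.≮⇒≥ λ r<p → ∄smaller (r , Pr , r<p)

module _ (G : Digraph) where
  open Digraph G

  ∈N⁻⁺ : ∀ {u v} → v ⟶ u → v ∈ N⁻ u
  ∈N⁻⁺ {u} {v} v⟶u = lookup⇒[]= v (N⁻ u)
    (trans (lookup∘tabulate _ v) (dec-true (v ⟶? u) v⟶u))

  ∈N⁻⁻ : ∀ {u v} → v ∈ N⁻ u → v ⟶ u
  -- The decision is abstracted together with the equation on its boolean, so that the answer `no`
  -- makes that equation absurd.
  ∈N⁻⁻ {u} {v} v∈N with v ⟶? u | trans (sym (lookup∘tabulate (λ v → does (v ⟶? u)) v)) ([]=⇒lookup v∈N)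
  ... | yes v⟶u | _  = v⟶u
  ... | no  _   | ()

  ∈N⁻[]⁺ : ∀ {u v} → v ≡ u ⊎ v ⟶ u → v ∈ N⁻[ u ]
  ∈N⁻[]⁺ {u} (inj₁ refl) = x∈p∪q⁺ (inj₁ (x∈⁅x⁆ u))
  ∈N⁻[]⁺     (inj₂ v⟶u)  = x∈p∪q⁺ (inj₂ (∈N⁻⁺ v⟶u))

  ∈N⁻[]⁻ : ∀ {u v} → v ∈ N⁻[ u ] → v ≡ u ⊎ v ⟶ u
  ∈N⁻[]⁻ {u} = Sum.map (x∈⁅y⁆⇒x≡y u) ∈N⁻⁻ ∘ x∈p∪q⁻ ⁅ u ⁆ (N⁻ u)

  isIdentifyingCode? : Decidable IsIdentifyingCode
  isIdentifyingCode? C =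
    all? (λ x → any? λ c → (c ∈? C) ×-dec (x ∈? N⁺[ c ]))
    ×-dec
    all? (λ x → all? λ y → ¬? (x ≟ y) →-dec
      ¬? (≡-dec _≟ᵇ_ (N⁻[ x ] ∩ C) (N⁻[ y ] ∩ C)))

  twin-free⇒⊤-isIdentifyingCode :
    (∀ x y → x ≢ y → N⁻[ x ] ≢ N⁻[ y ]) → IsIdentifyingCode ⊤
  twin-free⇒⊤-isIdentifyingCode twin-free =
    (λ x → x , ∈⊤ , x∈p∪q⁺ (inj₁ (x∈⁅x⁆ x))) ,
    (λ x y x≢y eq → twin-free x y x≢y
      (trans (sym (∩-identityʳ N⁻[ x ])) (trans eq (∩-identityʳ N⁻[ y ]))))

  -- A vertex `x` outside `C` adds nothing to its own trace `N⁻[ x ] ∩ C`, which thus depends only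
  -- on the open in-neighbourhood.
  separating⇒N⁻-injective-on-∁ : ∀ {C} → Separating C → ∀ {x y} → x ∉ C → y ∉ C →
    (∀ {c} → c ⟶ x → c ⟶ y) → (∀ {c} → c ⟶ y → c ⟶ x) → x ≡ y
  separating⇒N⁻-injective-on-∁ {C} sep {x} {y} x∉C y∉C x⇒y y⇒x =
    decidable-stable (x ≟ y) λ x≢y →
      sep x y x≢y (⊆-antisym (traces-⊆ x∉C x⇒y) (traces-⊆ y∉C y⇒x))
    where
    traces-⊆ : ∀ {x y} → x ∉ C → (∀ {c} → c ⟶ x → c ⟶ y) → N⁻[ x ] ∩ C ⊆ N⁻[ y ] ∩ C
    traces-⊆ {x} x∉C x⇒y c∈ with x∈p∩q⁻ N⁻[ x ] C c∈
    ... | c∈N , c∈C with ∈N⁻[]⁻ c∈N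
    ...   | inj₁ refl = contradiction c∈C x∉C
    ...   | inj₂ c⟶x  = x∈p∩q⁺ (∈N⁻[]⁺ (inj₂ (x⇒y c⟶x)) , c∈C)

module _ (D : Digraph) where
  open Digraph D
  private module L = Digraph (LD D)

  -- Vertices of `LD D` are list positions, so an arc known by its ends must be located in the list
  -- before it can serve as a vertex.
  arc-index : ∀ {u v} → u ⟶ v → ∃[ a ] (tail a ≡ u × head a ≡ v)
  arc-index {u} {v} u⟶v =
    index uv∈arcs , cong proj₁ (sym (lookup-index uv∈arcs)) , cong proj₂ (sym (lookup-index uv∈arcs))
    where
    uv∈arcs = ∈-filter⁺ (λ (u , v) → u ⟶? v)
      (∈-cartesianProduct⁺ (∈-allFin u) (∈-allFin v)) u⟶v

  LD-twin-free : MinInDegree≥ 2 → ∀ x y → x ≢ y → L.N⁻[ x ] ≢ L.N⁻[ y ]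
  LD-twin-free δ⁻≥2 x y x≢y eq
    with ∈N⁻[]⁻ (LD D) (subst (x ∈_) eq (∈N⁻[]⁺ (LD D) (inj₁ refl)))
  ... | inj₁ x≡y = x≢y x≡y
  ... | inj₂ hx≡ty
    -- The arc `c` from `w` to `tail x` lies in the closed in-neighbourhood of `x`, hence in that of
    -- `y`. Either `c` is `y`, against `w ≢ tail y`, or `tail x`, `head c`, `tail y` and `head x`
    -- all coincide and `x` is a loop.
    with w , w∈N , w≢ty ← 2≤∣p∣⇒∃≢ (δ⁻≥2 (tail x)) (tail y)
    with c , refl , hc≡tx ← arc-index (∈N⁻⁻ D w∈N)
    with ∈N⁻[]⁻ (LD D) (subst (c ∈_) eq (∈N⁻[]⁺ (LD D) (inj₂ hc≡tx)))
  ...   | inj₁ refl  = w≢ty refl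
  ...   | inj₂ hc≡ty = irrefl (trans (sym hc≡tx) (trans hc≡ty (sym hx≡ty))) (tail⟶head x)

  separating⇒size∸order≤∣C∣ : ∀ C → L.Separating C → size ∸ order ≤ ∣ C ∣
  -- With `order` moved to the right, only an upper bound on `size` remains, and the truncation of
  -- `∸` needs no case distinction.
  separating⇒size∸order≤∣C∣ C sep = ℕ.m≤n+o⇒m∸n≤o size order (begin
    size                    ≤⟨ ℕ.m≤n+m∸n size ∣ C ∣ ⟩
    ∣ C ∣ + (size ∸ ∣ C ∣)  ≡⟨ cong (∣ C ∣ +_) (∣∁p∣≡n∸∣p∣ C) ⟨
    ∣ C ∣ + ∣ ∁ C ∣         ≤⟨ ℕ.+-monoʳ-≤ ∣ C ∣ ∣∁C∣≤order ⟩
    ∣ C ∣ + order           ≡⟨ ℕ.+-comm ∣ C ∣ order ⟩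
    order + ∣ C ∣           ∎)
    where
    open ≤-Reasoning

    ∣∁C∣≤order : ∣ ∁ C ∣ ≤ order
    ∣∁C∣≤order = ℕ.≤-trans
      (injective-on⇒∣p∣≤∣q∣ (∁ C) ⊤ tail (λ _ → ∈⊤) λ x∈∁C y∈∁C tx≡ty →
        separating⇒N⁻-injective-on-∁ (LD D) sep (x∈∁p⇒x∉p x∈∁C) (x∈∁p⇒x∉p y∈∁C)
          -- The in-neighbours of `x` in `LD D` are the arcs ending at `tail x`, so equal tails give
          -- equal in-neighbourhoods.
          (λ hc≡tx → trans hc≡tx tx≡ty) (λ hc≡ty → trans hc≡ty (sym tx≡ty)))
      (∣p∣≤n ⊤)

theorem3p1 : (D : Digraph) → Digraph.StronglyConnected D → Digraph.MinInDegree≥ D 2 →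
    ∃[ k ] ((γID[ LD D ]≡ k) × k ≥ Digraph.size D ∸ Digraph.order D)
theorem3p1 D _ δ⁻≥2
  -- The set of all arcs is a code by twin-freeness, and the descent to a minimum code starts from
  -- it.
  with C , isCode , C-min ← minimum (isIdentifyingCode? (LD D)) ⊤
         (twin-free⇒⊤-isIdentifyingCode (LD D) (LD-twin-free D δ⁻≥2)) =
  ∣ C ∣ , ((C , isCode , refl) , C-min) , separating⇒size∸order≤∣C∣ D C (proj₂ isCode)
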